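{- Let $P$ be a (naturally labeled) rooted tree on $n$ elements. Then $$\mathcal{G}_{\mathrm{Ldes}}(P,z) \;=\; A^{(2)}_n(z).$$
   Context: All posets are finite. A poset $P$ is a rooted tree if it has a unique minimal element and its Hasse diagram is a tree. For a poset $(P,\preceq)$, $a \lessdot b$ denotes a cover relation, and $\check{P} = P \cup \{\hat 0\}$ is $P$ with a new minimum $\hat 0$ adjoined (even if $P$ already has a minimum). $P$ is naturally labeled if its ground set is $\{1,\dots,n\}$, $n = |P|$, and $a \prec b$ implies $a < b$ as integers; one sets $\hat 0 := 0$. For $\tau \in \mathfrak{S}_n$ set $\tau(0) := 0$. For a saturated chain $C = \{\hat 0 = c_1 \lessdot \cdots \lessdot c_k = a\}$ in $\check{P}$ let $\mathrm{des}(\tau|_C)$ be the number of $1 \le j < k$ with $\tau(c_j) > \tau(c_{j+1})$. The permutation $\tau$ is descent-compatible with $P$ if for every $a \in P$ the number $\mathrm{des}(\tau|_C)$ is the same for all saturated chains $C$ in $\check{P}$ from $\hat 0$ to $a$; then $\mathrm{des}_{P,\tau}(a)$ denotes this common number, and $\mathrm{des}_{P,\tau}(\hat 0) := 0$. $\mathrm{DC}(P) \subseteq \mathfrak{S}_n$ is the set of descent-compatible permutations. For $\tau \in \mathrm{DC}(P)$, $\mathrm{Ldes}_P(\tau)$ is the number of pairs $(a,b) \in \check{P} \times \check{P}$ with $\tau(a) = \tau(b) - 1$ such that either $\mathrm{des}_{P,\tau}(a) < \mathrm{des}_{P,\tau}(b)$, or $\mathrm{des}_{P,\tau}(a) = \mathrm{des}_{P,\tau}(b)$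 and $a > b$ (as integers). Define $\mathcal{G}_{\mathrm{Ldes}}(P,z) = \sum_{\tau \in \mathrm{DC}(P)} z^{\mathrm{Ldes}_P(\tau)}$. A big ascent of $\tau \in \mathfrak{S}_n$ is an index $0 \le i < n$ with $\tau(i+1) - \tau(i) \ge 2$ (where $\tau(0)=0$); $\mathrm{asc}^{(2)}(\tau)$ is the number of big ascents, and $A^{(2)}_n(z) = \sum_{\tau \in \mathfrak{S}_n} z^{\mathrm{asc}^{(2)}(\tau)}$. -}

module Defs where

open import Data.Bool.Base using (if_then_else_)
open import Data.Fin.Base as Fin using (Fin; zero; suc; toℕ; inject₁; punchIn)
import Data.Fin.Properties as Fin
open import Data.Fin.Permutation
  using (Permutation′; _⟨$⟩ʳ_; _≈_; id; insert; remove; lift₀; insert-punchIn; insert-remove)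
open import Data.List.Base
  using (List; []; _∷_; [_]; _++_; _∷ʳ_; length; map; foldr; filter; replicate; allFin;
         cartesianProduct; cartesianProductWith)
open import Data.List.Membership.Propositional.Properties using (∈-allFin)
open import Data.List.Relation.Unary.All as All using (All; []; _∷_)
import Data.List.Relation.Unary.All.Properties as All
open import Data.List.Relation.Unary.AllPairs as AllPairs using (AllPairs; []; _∷_)
import Data.List.Relation.Unary.AllPairs.Properties as AllPairs
open import Data.List.Relation.Unary.Any as Any using (Any; here; there)
import Data.List.Relation.Unary.Any.Properties as Any
open import Data.List.Relation.Unary.Linked using (Linked)
open import Data.List.Relation.Unary.Unique.Propositional using (Unique)
import Data.List.Relation.Unary.Unique.Propositional.Properties as Unique
open import Data.Nat.Base using (ℕ; zero; suc; _+_; _≤_; _<_; z≤n; s≤s; s≤s⁻¹)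
import Data.Nat.Properties as ℕ
open import Data.Product.Base using (_×_; _,_; proj₁; proj₂; ∃; ∃-syntax)
open import Data.Product using (∃!)
open import Data.Sum.Base using (_⊎_)
open import Function.Base using (_∘_)
open import Level using (0ℓ) renaming (suc to lsuc)
open import Relation.Binary.Construct.Add.Infimum.NonStrict as Infimum using (⊥₋≤_)
import Relation.Binary.Construct.NonStrictToStrict as ToStrict
open import Relation.Binary.Construct.Closure.ReflexiveTransitive using (Star; ε; _◅_; _◅◅_)
open import Relation.Binary.Construct.Closure.Symmetric using (SymClosure)
open import Relation.Binary.Core using (Rel)
open import Relation.Binary.Definitions using (Decidable)
open import Relation.Binary.PropositionalEquality
  using (_≡_; _≢_; refl; sym; trans; cong; module ≡-Reasoning)
open import Relation.Binary.Structures using (IsDecPartialOrder)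
open import Relation.Nullary.Construct.Add.Infimum using (_₋; ⊥₋) renaming ([_] to ι)
open import Relation.Nullary.Decidable using (Dec; yes; no; does; map′; ¬?; _×-dec_; _⊎-dec_; _→-dec_)
open import Relation.Nullary.Negation using (¬_; contradiction)
import Relation.Unary as U

-- Polynomials in z with natural coefficients, constant term first.
-- Trailing zeros are allowed, so equality is coefficientwise.

ℕ[z] : Set
ℕ[z] = List ℕ

coeff : ℕ[z] → ℕ → ℕ
coeff []      _       = 0
coeff (c ∷ p) zero    = c
coeff (c ∷ p) (suc k) = coeff p k

infix 4 _≋_

_≋_ : Rel ℕ[z] 0ℓ
p ≋ q = ∀ k → coeff p k ≡ coeff q k

infixl 6 _⊞_

_⊞_ : ℕ[z] → ℕ[z] → ℕ[z]
[]      ⊞ q       = q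
(c ∷ p) ⊞ []      = c ∷ p
(c ∷ p) ⊞ (d ∷ q) = c + d ∷ p ⊞ q

z^_ : ℕ → ℕ[z]
z^ k = replicate k 0 ++ [ 1 ]

Σz^ : ∀ {a} {A : Set a} → (A → ℕ) → List A → ℕ[z]
Σz^ stat = foldr (λ x p → z^ stat x ⊞ p) []

-- The element i + 1 of the ground set {1, …, n} is represented by i : Fin n.
-- Each permutation is listed exactly once up to pointwise equality: see
-- 𝔖-complete and 𝔖-distinct.

𝔖 : ∀ n → List (Permutation′ n)
𝔖 zero    = [ id ]
𝔖 (suc n) = cartesianProductWith (insert zero) (allFin (suc n)) (𝔖 n)

private
  insert-zero : ∀ {n} j (π : Permutation′ n) → insert zero j π ⟨$⟩ʳ zero ≡ j
  insert-zero j π = refl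

  insert-suc : ∀ {n} j (π : Permutation′ n) k →
               insert zero j π ⟨$⟩ʳ suc k ≡ punchIn j (π ⟨$⟩ʳ k)
  insert-suc j π k = insert-punchIn zero j π k

  insert-cong : ∀ {n} {i j} {π ρ : Permutation′ n} → i ≡ j → π ≈ ρ →
                insert zero i π ≈ insert zero j ρ
  insert-cong {i = i} {π = π} {ρ} refl π≈ρ zero = trans (insert-zero i π) (sym (insert-zero i ρ))
  insert-cong {i = i} {π = π} {ρ} refl π≈ρ (suc k) =
    trans (insert-suc i π k) (trans (cong (punchIn i) (π≈ρ k)) (sym (insert-suc i ρ k)))

  insert-injective : ∀ {n} {i j} {π ρ : Permutation′ n} →
                     insert zero i π ≈ insert zero j ρ → i ≡ j × π ≈ ρ
  insert-injective {i = i} {j} {π} {ρ} eq with trans (sym (insert-zero i π)) (trans (eq zero) (insert-zero j ρ))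
  ... | refl = refl , λ k → Fin.punchIn-injective i _ _
    (trans (sym (insert-suc i π k)) (trans (eq (suc k)) (insert-suc i ρ k)))

𝔖-complete : ∀ {n} (π : Permutation′ n) → Any (π ≈_) (𝔖 n)
𝔖-complete {zero}  π = here λ ()
𝔖-complete {suc n} π =
  Any.cartesianProductWith⁺ (insert zero)
    (λ p q k → trans (sym (insert-remove zero π k)) (insert-cong p q k))
    (∈-allFin (π ⟨$⟩ʳ zero)) (𝔖-complete (remove zero π))

𝔖-distinct : ∀ n → AllPairs (λ π ρ → ¬ π ≈ ρ) (𝔖 n)
𝔖-distinct zero    = [] ∷ []
𝔖-distinct (suc n) = go (Unique.allFin⁺ (suc n))
  where
  go : ∀ {js} → Unique js →
       AllPairs (λ π ρ → ¬ π ≈ ρ) (cartesianProductWith (insert zero) js (𝔖 n))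
  go []                        = []
  go {j ∷ js} (j∉js ∷ js!) = AllPairs.++⁺
    (AllPairs.map⁺ (AllPairs.map (λ π≉ρ eq → π≉ρ (proj₂ (insert-injective eq))) (𝔖-distinct n)))
    (go js!)
    (All.map⁺ (All.universal (λ π → other π j∉js) (𝔖 n)))
    where
    other : ∀ π {is} → All (j ≢_) is →
            All (λ ρ → ¬ insert zero j π ≈ ρ) (cartesianProductWith (insert zero) is (𝔖 n))
    other π []             = []
    other π (j≢i ∷ j∉is) = All.++⁺
      (All.map⁺ (All.universal (λ ρ eq → j≢i (proj₁ (insert-injective eq))) (𝔖 n)))
      (other π j∉is)

-- τ extended by τ(0) = 0. Here zero and suc i in Fin (suc n) stand for
-- the integers 0 and toℕ i + 1.
infix 9 _⟨_⟩

_⟨_⟩ : ∀ {n} → Permutation′ n → Fin (suc n) → Fin (suc n)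
τ ⟨ i ⟩ = lift₀ τ ⟨$⟩ʳ i

BigAscent : ∀ {n} → Permutation′ n → Fin n → Set
BigAscent τ i = 2 + toℕ (τ ⟨ inject₁ i ⟩) ≤ toℕ (τ ⟨ suc i ⟩)

bigAscent? : ∀ {n} (τ : Permutation′ n) → U.Decidable (BigAscent τ)
bigAscent? τ i = _ ℕ.≤? _

asc² : ∀ {n} → Permutation′ n → ℕ
asc² {n} τ = length (filter (bigAscent? τ) (allFin n))

A² : ℕ → ℕ[z]
A² n = Σz^ asc² (𝔖 n)

module Order {a ℓ} {A : Set a} (_≼_ : Rel A ℓ) where

  open ToStrict _≡_ _≼_ public using () renaming (_<_ to _≺_)

  infix 4 _⋖_

  _⋖_ : Rel A _
  x ⋖ y = x ≺ y × ¬ (∃[ z ] x ≺ z × z ≺ y)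

  Minimal : A → Set _
  Minimal x = ∀ y → ¬ (y ≺ x)

module Graph {a ℓ} {V : Set a} (_~_ : Rel V ℓ) where

  record Cycle : Set (a Level.⊔ ℓ) where
    field
      v        : V
      vs       : List V
      long     : 2 ≤ length vs
      distinct : Unique (v ∷ vs)
      closed   : Linked _~_ (v ∷ vs ∷ʳ v)

  record IsTree : Set (a Level.⊔ ℓ) where
    field
      connected : ∀ x y → Star _~_ x y
      acyclic   : ¬ Cycle

record NaturallyLabeledPoset (n : ℕ) ℓ : Set (lsuc ℓ) where
  infix 4 _≼_
  field
    _≼_               : Rel (Fin n) ℓ
    isDecPartialOrder : IsDecPartialOrder _≡_ _≼_

  open Order _≼_ public

  field
    natural : ∀ {a b} → a ≺ b → a Fin.< b

  Hasse : Rel (Fin n) ℓ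
  Hasse = SymClosure _⋖_

  record IsRootedTree : Set ℓ where
    field
      uniqueMinimal : ∃! _≡_ Minimal
      hasseTree     : Graph.IsTree Hasse

private
  any₋? : ∀ {n p} {Q : Fin n ₋ → Set p} → U.Decidable Q → Dec (∃ Q)
  any₋? Q? with Q? ⊥₋ | Fin.any? (Q? ∘ ι)
  ... | yes q | _           = yes (⊥₋ , q)
  ... | no ¬q | yes (a , q) = yes (ι a , q)
  ... | no ¬q | no ¬qs      = no λ { (⊥₋ , q) → ¬q q ; (ι a , q) → ¬qs (a , q) }

  all₋? : ∀ {n p} {Q : Fin n ₋ → Set p} → U.Decidable Q → Dec (∀ x → Q x)
  all₋? Q? = map′ (λ { (q , qs) ⊥₋ → q ; (q , qs) (ι a) → qs a })
                  (λ f → f ⊥₋ , f ∘ ι)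
                  (Q? ⊥₋ ×-dec Fin.all? (Q? ∘ ι))

module _ {n ℓ} (P : NaturallyLabeledPoset n ℓ) where

  open NaturallyLabeledPoset P using (_≼_; isDecPartialOrder; natural)

  private
    module ≼₋ = IsDecPartialOrder (Infimum.≤₋-isDecPartialOrder-≡ _≼_ isDecPartialOrder)

  -- The new minimum 0̂ is ⊥₋, and ι a is the element a of P.
  P̌ : Set
  P̌ = Fin n ₋

  P̌-elements : List P̌
  P̌-elements = ⊥₋ ∷ map ι (allFin n)

  open Order (Infimum._≤₋_ _≼_) public using () renaming (_≺_ to _≺̌_; _⋖_ to _⋖̌_)

  -- The integer label, with 0̂ labelled 0.
  label : P̌ → Fin (suc n)
  label ⊥₋    = zero
  label (ι a) = suc a

  SaturatedChain : Rel P̌ ℓ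
  SaturatedChain = Star _⋖̌_

  module _ (τ : Permutation′ n) where

    descent : P̌ → P̌ → ℕ
    descent x y = if does (τ ⟨ label y ⟩ Fin.<? τ ⟨ label x ⟩) then 1 else 0

    des : ∀ {x y} → SaturatedChain x y → ℕ
    des ε                   = 0
    des (_◅_ {x} {y} _ C) = descent x y + des C

    DescentCompatible : Set ℓ
    DescentCompatible = ∀ a (C C′ : SaturatedChain ⊥₋ (ι a)) → des C ≡ des C′

  private
    _≺̌?_ : Decidable _≺̌_
    _≺̌?_ = ToStrict.<-decidable _≡_ (Infimum._≤₋_ _≼_) ≼₋._≟_ ≼₋._≤?_

    between? : ∀ x y → Dec (∃[ z ] x ≺̌ z × z ≺̌ y)
    between? x y = any₋? λ z → (x ≺̌? z) ×-dec (z ≺̌? y)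

    _⋖̌?_ : Decidable _⋖̌_
    x ⋖̌? y = (x ≺̌? y) ×-dec ¬? (between? x y)

    label-mono : ∀ {x y} → x ≺̌ y → label x Fin.< label y
    label-mono {⊥₋}  {⊥₋}  (_ , x≢y)                  = contradiction refl x≢y
    label-mono {⊥₋}  {ι b} _                          = s≤s z≤n
    label-mono {ι a} {ι b} (Infimum.[ a≼b ] , a≢b) = s≤s (natural (a≼b , a≢b ∘ cong ι))

    refine : ∀ fuel {x y} → x ≺̌ y → toℕ (label y) ≤ fuel + toℕ (label x) → SaturatedChain x y
    refine zero       x≺y le = contradiction (label-mono x≺y) (ℕ.≤⇒≯ le)
    refine (suc fuel) {x} {y} x≺y le with between? x y
    ... | no  ¬xzy            = (x≺y , ¬xzy) ◅ ε
    ... | yes (z , x≺z , z≺y) =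
      refine fuel x≺z (s≤s⁻¹ (ℕ.≤-trans (label-mono z≺y) le)) ◅◅
      refine fuel z≺y (ℕ.≤-trans le (ℕ.≤-trans (ℕ.≤-reflexive (sym (ℕ.+-suc fuel _)))
                                                (ℕ.+-monoʳ-≤ fuel (label-mono x≺z))))

  saturatedChain : ∀ x → SaturatedChain ⊥₋ x
  saturatedChain ⊥₋    = ε
  saturatedChain (ι a) = refine (suc (toℕ a)) ((⊥₋≤ ι a) , λ ()) (ℕ.m≤m+n (suc (toℕ a)) 0)

  module _ (τ : Permutation′ n) where

    -- The common number of descents along all saturated chains to x when
    -- τ is descent-compatible (a junk value otherwise), read off one of them.
    desAt : P̌ → ℕ
    desAt x = des τ (saturatedChain x)

    desAt-common : DescentCompatible τ → ∀ a (C : SaturatedChain ⊥₋ (ι a)) → des τ C ≡ desAt (ι a)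
    desAt-common dc a C = dc a C (saturatedChain (ι a))

    private
      Local : Set ℓ
      Local = ∀ x y → x ⋖̌ y → desAt y ≡ desAt x + descent τ x y

      des-◅◅ : ∀ {x y z} (C : SaturatedChain x y) (D : SaturatedChain y z) →
               des τ (C ◅◅ D) ≡ des τ C + des τ D
      des-◅◅ ε D = refl
      des-◅◅ (_◅_ {x} {y} _ C) D =
        trans (cong (descent τ x y +_) (des-◅◅ C D)) (sym (ℕ.+-assoc (descent τ x y) _ _))

      toLocal : DescentCompatible τ → Local
      toLocal dc x ⊥₋    ((Infimum.⊥₋≤ _ , x≢⊥) , _) = contradiction refl x≢⊥
      toLocal dc x (ι b) x⋖b = begin
        desAt (ι b)                               ≡⟨ dc b (saturatedChain (ι b)) (saturatedChain x ◅◅ x⋖b ◅ ε) ⟩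
        des τ (saturatedChain x ◅◅ x⋖b ◅ ε)       ≡⟨ des-◅◅ (saturatedChain x) (x⋖b ◅ ε) ⟩
        desAt x + (descent τ x (ι b) + 0)         ≡⟨ cong (desAt x +_) (ℕ.+-identityʳ _) ⟩
        desAt x + descent τ x (ι b)               ∎
        where open ≡-Reasoning

      along : Local → ∀ {x y} (C : SaturatedChain x y) → desAt y ≡ desAt x + des τ C
      along loc {x} ε = sym (ℕ.+-identityʳ _)
      along loc {x} (_◅_ {_} {y} x⋖y C) = trans (along loc C)
        (trans (cong (_+ des τ C) (loc x y x⋖y)) (ℕ.+-assoc (desAt x) _ _))

      fromLocal : Local → DescentCompatible τ
      fromLocal loc a C C′ = trans (sym (along loc C)) (along loc C′)

    descentCompatible? : Dec (DescentCompatible τ)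
    descentCompatible? = map′ fromLocal toLocal
      (all₋? λ x → all₋? λ y → (x ⋖̌? y) →-dec (desAt y ℕ.≟ (desAt x + descent τ x y)))

    LdesPair : P̌ × P̌ → Set
    LdesPair (a , b) =
      suc (toℕ (τ ⟨ label a ⟩)) ≡ toℕ (τ ⟨ label b ⟩) ×
      (desAt a < desAt b ⊎ (desAt a ≡ desAt b × label b Fin.< label a))

    ldesPair? : U.Decidable LdesPair
    ldesPair? (a , b) =
      (_ ℕ.≟ _) ×-dec ((_ ℕ.<? _) ⊎-dec ((_ ℕ.≟ _) ×-dec (_ Fin.<? _)))

    Ldes : ℕ
    Ldes = length (filter ldesPair? (cartesianProduct P̌-elements P̌-elements))

  DC : List (Permutation′ n)
  DC = filter descentCompatible? (𝔖 n)

  𝓖Ldes : ℕ[z]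
  𝓖Ldes = Σz^ Ldes DC

{-# OPTIONS --safe #-}

-- Write a permutation ρ as the word 0, ρ(1), …, ρ(n). Then asc² ρ counts the adjacent pairs
-- (x, y) with x + 2 ≤ y, and Ldes P ρ⁻¹ counts the adjacent pairs that increase in the order by
-- level, ties broken towards the larger label first. Every word on 0, …, n + 1 arises by inserting
-- n + 1 after some letter of a word on 0, …, n; if the latter has statistic k, then under both
-- statistics exactly k + 1 of the insertions keep k and the other n - k raise it to k + 1, so the
-- two distributions agree by induction on n. For Ldes, inserting n + 1 does not change the other
-- levels, because n + 1 is a leaf; its own level depends only on whether it is placed before or
-- after its parent. Of the rooted tree one needs only that lower covers are unique: this makes
-- every permutation descent-compatible.
module Submission where

open import Defs
import Data.Nat.Properties
open import Algebra.Properties.CommutativeMonoid.Sum Data.Nat.Properties.+-0-commutativeMonoid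
  using (sum-syntax; sum⁺-syntax; sum-cong-≗; sum-replicate-zero; ∑-permute)
open import Data.Bool.Base using (Bool; true; false; not; _∧_; _∨_; if_then_else_)
open import Data.Fin.Base as Fin
  using (Fin; zero; suc; toℕ; fromℕ; fromℕ<; inject₁; punchIn; punchOut)
import Data.Fin.Properties as Fin
open import Data.Fin.Permutation
  using (Permutation; Permutation′; _⟨$⟩ʳ_; _⟨$⟩ˡ_; _≈_; insert; remove; lift₀; flip;
         insert-remove; inverseˡ; inverseʳ)
open import Data.List.Base
  using (List; []; _∷_; [_]; _++_; _∷ʳ_; length; map; filter; tabulate; allFin;
         cartesianProduct; cartesianProductWith)
open import Data.List.Membership.Propositional using (_∈_)
open import Data.List.Membership.Propositional.Properties using (∈-allFin; ∈-tabulate⁺)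
open import Data.List.Properties
  using (filter-all; length-++; length-map; length-tabulate; map-++; map-cong; map-tabulate;
         map-∘; tabulate-cong)
open import Data.List.Relation.Unary.All as All using (All; []; _∷_)
import Data.List.Relation.Unary.All.Properties as All
open import Data.List.Relation.Unary.AllPairs using (AllPairs; []; _∷_)
open import Data.List.Relation.Unary.Any as Any using (Any; here; there)
import Data.List.Relation.Unary.Any.Properties as Any
open import Data.List.Relation.Unary.Linked using (Linked; [-]; _∷_)
open import Data.List.Relation.Unary.Unique.Propositional using (Unique)
import Data.List.Relation.Unary.Unique.Propositional.Properties as Unique
open import Data.Nat.Base
open import Data.Nat.ListAction using (sum)
open import Data.Nat.ListAction.Properties using (sum-++)
open import Data.Nat.Properties
open import Data.Nat.Tactic.RingSolver using (solve-∀)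
open import Data.Product.Base using (_×_; _,_; proj₁; proj₂; ∃-syntax)
open import Data.Sum.Base using (_⊎_; inj₁; inj₂)
open import Data.Vec.Functional using (insertAt)
open import Data.Vec.Functional.Properties using (insertAt-lookup; insertAt-punchIn)
open import Function.Base using (_∘_; id)
open import Function.Bundles using (mk⇔)
open import Relation.Binary.Construct.Add.Infimum.NonStrict as Infimum using (⊥₋≤_)
open import Relation.Binary.Construct.Closure.ReflexiveTransitive using (Star; ε; _◅_)
open import Relation.Binary.Construct.Closure.Symmetric using (fwd; bwd)
open import Relation.Binary.Core using (Rel)
open import Relation.Binary.Definitions using (Symmetric; Transitive; tri<; tri≈; tri>)
open import Relation.Binary.PropositionalEquality
  using (_≡_; _≢_; _≗_; refl; sym; trans; cong; cong₂; subst; module ≡-Reasoning)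
open import Relation.Nullary.Construct.Add.Infimum using (⊥₋) renaming ([_] to ι)
open import Relation.Nullary.Decidable
  using (Dec; yes; no; does; dec-true; dec-false; does-⇔; ¬?; _×-dec_; _⊎-dec_)
open import Relation.Nullary.Negation using (contradiction; ¬_)
open import Relation.Unary using (Decidable)

-- Words: adjacent pairs and insertions

𝟙 : Bool → ℕ
𝟙 b = if b then 1 else 0

-- The first letter is kept apart because words start with the fixed letter `0`, in front of which
-- nothing is inserted.
adjacencies : (ℕ → ℕ → Bool) → ℕ → List ℕ → ℕ
adjacencies R x []      = 0
adjacencies R x (y ∷ w) = 𝟙 (R x y) + adjacencies R y w

adjacencies-cong : ∀ {p} {P : ℕ → Set p} {R S : ℕ → ℕ → Bool} →
           (∀ {x y} → P x → P y → R x y ≡ S x y) →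
           ∀ {x w} → All P (x ∷ w) → adjacencies R x w ≡ adjacencies S x w
adjacencies-cong R≗S (_ ∷ [])              = refl
adjacencies-cong R≗S (px ∷ ps@(py ∷ _)) =
  cong₂ (λ b k → 𝟙 b + k) (R≗S px py) (adjacencies-cong R≗S ps)

adjacencies-complement : ∀ R x w →
  adjacencies (λ y z → not (R y z)) x w ≡ length w ∸ adjacencies R x w
adjacencies-complement R x w =
  trans (sym (m+n∸m≡n (adjacencies R x w) _)) (cong (_∸ adjacencies R x w) (split x w))
  where
  split : ∀ x w → adjacencies R x w + adjacencies (λ y z → not (R y z)) x w ≡ length w
  split x []      = refl
  split x (y ∷ w) with R x y
  ... | true  = cong suc (split y w)
  ... | false = trans (+-suc _ _) (cong suc (split y w))

-- Letters already passed are absorbed into `f`; hence the counting lemmas below allow an arbitrary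
-- weight `F`.
Σins : (List ℕ → ℕ) → ℕ → List ℕ → ℕ
Σins f v []      = f [ v ]
Σins f v (y ∷ w) = f (v ∷ y ∷ w) + Σins (f ∘ (y ∷_)) v w

-- The split of `w` is passed on because a level statistic recomputes all levels from the whole
-- word, so the comparison must know what remains when `v` is removed.
Σins-cong : ∀ {f g} v w → (∀ xs {ys} → xs ++ ys ≡ w → f (xs ++ v ∷ ys) ≡ g (xs ++ v ∷ ys)) →
            Σins f v w ≡ Σins g v w
Σins-cong v []      f≗g = f≗g [] refl
Σins-cong v (y ∷ w) f≗g = cong₂ _+_ (f≗g [] refl) (Σins-cong v w λ xs → f≗g (y ∷ xs) ∘ cong (y ∷_))

before : ℕ → ℕ → List ℕ → Bool
before i j []      = false
before i j (x ∷ w) = (x ≡ᵇ i) ∨ (not (x ≡ᵇ j) ∧ before i j w)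

-- Counting the insertions that keep or raise a statistic

-- The case distinction behind the count of insertions: x and y are consecutive letters, r tells
-- whether they count, and k and e count the adjacent pairs from y on that do and do not count. The
-- flags a and a′ tell whether x and y rank above the inserted letter. The offset (𝟙 a + c) is
-- moved to the left so that no subtraction occurs; c is 1 before the marker and 0 after it.
insertion-step : ∀ (F : ℕ → ℕ) a a′ r c k e S →
  (a ≡ false → a′ ≡ true → r ≡ true) → (a ≡ true → a′ ≡ false → r ≡ false) →
  S + (𝟙 a′ + c) * F (𝟙 r + suc k) ≡ (k + (𝟙 a′ + c)) * F (𝟙 r + k) + suc e * F (𝟙 r + suc k) →
  F (𝟙 (not a) + (𝟙 a′ + k)) + S + (𝟙 a + c) * F (suc (𝟙 r + k)) ≡
  (𝟙 r + k + (𝟙 a + c)) * F (𝟙 r + k) + suc (𝟙 (not r) + e) * F (suc (𝟙 r + k))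
insertion-step F true true true c k e S up down ih =
  trans (p (F (suc k)) S _) (trans (cong (F (suc k) +_) ih) (q k c e (F (suc k)) (F (2 + k))))
  where
  p : ∀ x s y → x + s + y ≡ x + (s + y)
  p = solve-∀
  q : ∀ k c e x y → x + ((k + (1 + c)) * x + suc e * y) ≡ (suc k + (1 + c)) * x + suc e * y
  q = solve-∀
insertion-step F true true false c k e S up down ih =
  trans (p (F (suc k)) S _) (trans (cong (F (suc k) +_) ih) (q k c e (F k) (F (suc k))))
  where
  p : ∀ x s y → x + s + y ≡ x + (s + y)
  p = solve-∀
  q : ∀ k c e x y → y + ((k + (1 + c)) * x + suc e * y) ≡ (k + (1 + c)) * x + suc (suc e) * y
  q = solve-∀
insertion-step F true false true c k e S up down ih = contradiction (down refl refl) λ ()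
insertion-step F true false false c k e S up down ih =
  trans (p c (F k) S (F (suc k))) (trans (cong (F k + F (suc k) +_) ih) (q k c e (F k) (F (suc k))))
  where
  p : ∀ c x s y → x + s + (1 + c) * y ≡ x + y + (s + c * y)
  p = solve-∀
  q : ∀ k c e x y → x + y + ((k + c) * x + suc e * y) ≡ (k + (1 + c)) * x + suc (suc e) * y
  q = solve-∀
insertion-step F false true true c k e S up down ih =
  trans (p c S (F (2 + k))) (trans ih (q k c e (F (suc k)) (F (2 + k))))
  where
  p : ∀ c s y → y + s + c * y ≡ s + (1 + c) * y
  p = solve-∀
  q : ∀ k c e x y → (k + (1 + c)) * x + suc e * y ≡ (suc k + c) * x + suc e * y
  q = solve-∀
insertion-step F false true false c k e S up down ih = contradiction (up refl refl) λ ()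
insertion-step F false false true c k e S up down ih =
  trans (p (F (suc k)) S _) (trans (cong (F (suc k) +_) ih) (q k c e (F (suc k)) (F (2 + k))))
  where
  p : ∀ x s y → x + s + y ≡ x + (s + y)
  p = solve-∀
  q : ∀ k c e x y → x + ((k + c) * x + suc e * y) ≡ (suc k + c) * x + suc e * y
  q = solve-∀
insertion-step F false false false c k e S up down ih =
  trans (p (F (suc k)) S _) (trans (cong (F (suc k) +_) ih) (q k c e (F k) (F (suc k))))
  where
  p : ∀ x s y → x + s + y ≡ x + (s + y)
  p = solve-∀
  q : ∀ k c e x y → y + ((k + c) * x + suc e * y) ≡ (k + c) * x + suc (suc e) * y
  q = solve-∀

-- R x y tells whether an adjacent pair (x, y) of letters < v counts. Which pairs with v count may
-- depend on whether v is placed before (Rᵇ) or after (Rᵃ) the marker m; b and a are the sets of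
-- letters to be thought of as ranking above v in these two cases.
module Insertion
  (v m : ℕ) (m<v : m < v) (R Rᵇ Rᵃ : ℕ → ℕ → Bool) (b a : ℕ → Bool)
  (Rᵇ-old  : ∀ {x y} → x < v → y < v → Rᵇ x y ≡ R x y)
  (Rᵇ-to   : ∀ {x} → x < v → x ≢ m → Rᵇ x v ≡ not (b x))
  (Rᵇ-from : ∀ {y} → y < v → Rᵇ v y ≡ b y)
  (b-up    : ∀ {x y} → x < v → y < v → b x ≡ false → b y ≡ true → R x y ≡ true)
  (b-down  : ∀ {x y} → x < v → y < v → b x ≡ true → b y ≡ false → R x y ≡ false)
  (b-m     : b m ≡ false)
  (Rᵃ-old  : ∀ {x y} → x < v → y < v → Rᵃ x y ≡ R x y)
  (Rᵃ-to   : ∀ {x} → x < v → Rᵃ x v ≡ not (a x))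
  (Rᵃ-from : ∀ {y} → y < v → m ≢ y → Rᵃ v y ≡ a y)
  (a-up    : ∀ {x y} → x < v → y < v → m ≢ y → a x ≡ false → a y ≡ true → R x y ≡ true)
  (a-down  : ∀ {x y} → x < v → y < v → m ≢ y → a x ≡ true → a y ≡ false → R x y ≡ false)
  (a-m     : a m ≡ true)
  where

  R̄ : ℕ → ℕ → Bool
  R̄ x y = not (R x y)

  stat : ℕ → List ℕ → ℕ
  stat x u = adjacencies (if before v m (x ∷ u) then Rᵇ else Rᵃ) x u

  -- Inserting `v` between `x` and `y` replaces their pair by two, which contribute `not (a x)` and
  -- `a y`. If the flags agree, the statistic is kept exactly when `R x y` counts. A step from above
  -- `v` to below keeps it although `R x y` does not count; a step from below to above raises it
  -- although `R x y` counts. These corrections, with the final position, telescope to `𝟙 (a x)`.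
  after-marker : ∀ {x w} → All (_< v) (x ∷ w) → All (m ≢_) w → ∀ (F : ℕ → ℕ) →
    Σins (λ u → F (adjacencies Rᵃ x u)) v w + (𝟙 (a x) + 0) * F (suc (adjacencies R x w)) ≡
    (adjacencies R x w + (𝟙 (a x) + 0)) * F (adjacencies R x w) +
    suc (adjacencies R̄ x w) * F (suc (adjacencies R x w))
  after-marker {x} (x<v ∷ []) [] F rewrite Rᵃ-to x<v with a x
  ... | true  = cong (_+ 1 * F 1) (sym (+-identityʳ (F 0)))
  ... | false = refl
  after-marker {x} {y ∷ w} (x<v ∷ <v@(y<v ∷ _)) (m≢y ∷ m≢w) F =
    trans (cong (_+ (𝟙 (a x) + 0) * F (suc (adjacencies R x (y ∷ w)))) (cong₂ _+_
      (cong F (cong₂ _+_ (cong 𝟙 (Rᵃ-to x<v))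
        (cong₂ _+_ (cong 𝟙 (Rᵃ-from y<v m≢y)) (adjacencies-cong Rᵃ-old <v))))
      (Σins-cong v w λ xs _ → cong (λ r → F (𝟙 r + adjacencies Rᵃ y (xs ++ _))) (Rᵃ-old x<v y<v))))
    (insertion-step F (a x) (a y) (R x y) 0 (adjacencies R y w) (adjacencies R̄ y w) _
      (a-up x<v y<v m≢y) (a-down x<v y<v m≢y)
      (after-marker <v m≢w (λ k → F (𝟙 (R x y) + k))))

  -- A letter that is neither `v` nor the marker does not settle which of the two comes first, so
  -- the choice between `Rᵇ` and `Rᵃ` passes to the rest of the word.
  stat-∷ : ∀ {x y} → x < v → x ≢ m → y < v → ∀ u → stat x (y ∷ u) ≡ 𝟙 (R x y) + stat y u
  stat-∷ {x} {y} x<v x≢m y<v u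
    rewrite dec-false (x ≟ v) (<⇒≢ x<v) | dec-false (x ≟ m) x≢m with before v m (y ∷ u)
  ... | true  = cong (λ r → 𝟙 r + adjacencies Rᵇ y u) (Rᵇ-old x<v y<v)
  ... | false = cong (λ r → 𝟙 r + adjacencies Rᵃ y u) (Rᵃ-old x<v y<v)

  stat-ins : ∀ {x} → x < v → x ≢ m → ∀ u → stat x (v ∷ u) ≡ adjacencies Rᵇ x (v ∷ u)
  stat-ins {x} x<v x≢m u
    rewrite dec-false (x ≟ v) (<⇒≢ x<v) | dec-false (x ≟ m) x≢m | dec-true (v ≟ v) refl = refl

  stat-m : ∀ u → stat m u ≡ adjacencies Rᵃ m u
  stat-m u rewrite dec-false (m ≟ v) (<⇒≢ m<v) | dec-true (m ≟ m) refl = refl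

  -- The same telescoping with the flags `b`. The two regimes fit together at the marker, where
  -- `b m` is false and `a m` is true: `𝟙 (b m) + 1` equals `𝟙 (a m) + 0`, the offset of
  -- `after-marker`.
  until-marker : ∀ {x w} → All (_< v) (x ∷ w) → Unique (x ∷ w) → m ∈ x ∷ w → ∀ (F : ℕ → ℕ) →
    Σins (F ∘ stat x) v w + (𝟙 (b x) + 1) * F (suc (adjacencies R x w)) ≡
    (adjacencies R x w + (𝟙 (b x) + 1)) * F (adjacencies R x w) +
    suc (adjacencies R̄ x w) * F (suc (adjacencies R x w))
  until-marker {x} {w} <v (m≢w ∷ _) (here refl) F =
    subst (λ c → Σins (F ∘ stat m) v w + c * F (suc k) ≡
                 (k + c) * F k + suc (adjacencies R̄ m w) * F (suc k))
      (trans (cong (λ c → 𝟙 c + 0) a-m) (cong (λ c → 𝟙 c + 1) (sym b-m)))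
      (trans (cong (_+ (𝟙 (a m) + 0) * F (suc k))
                   (Σins-cong v w λ xs _ → cong F (stat-m (xs ++ _))))
             (after-marker <v m≢w F))
    where k = adjacencies R m w
  until-marker {x} {[]} _ _ (there ()) F
  until-marker {x} {y ∷ w} (x<v ∷ <v@(y<v ∷ _)) (x∉ ∷ w!) (there m∈) F =
    trans (cong (_+ (𝟙 (b x) + 1) * F (suc (adjacencies R x (y ∷ w)))) (cong₂ _+_
      (cong F (trans (stat-ins x<v x≢m (y ∷ w)) (cong₂ _+_ (cong 𝟙 (Rᵇ-to x<v x≢m))
        (cong₂ _+_ (cong 𝟙 (Rᵇ-from y<v)) (adjacencies-cong Rᵇ-old <v)))))
      (Σins-cong v w λ xs _ → cong F (stat-∷ x<v x≢m y<v (xs ++ _)))))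
    (insertion-step F (b x) (b y) (R x y) 1 (adjacencies R y w) (adjacencies R̄ y w) _
      (b-up x<v y<v) (b-down x<v y<v)
      (until-marker <v w! m∈ (λ k → F (𝟙 (R x y) + k))))
    where
    x≢m : x ≢ m
    x≢m = All.lookup x∉ m∈

  -- As `b x` is false, the offset is 1, so `k + 1` of the `length w + 1` insertions keep the
  -- statistic. The cancelled term is the offset that `until-marker` has on its left side.
  insertion : ∀ {x w} → b x ≡ false → All (_< v) (x ∷ w) → Unique (x ∷ w) → m ∈ x ∷ w →
    ∀ (F : ℕ → ℕ) → let k = adjacencies R x w in
    Σins (F ∘ stat x) v w ≡ suc k * F k + (length w ∸ k) * F (suc k)
  insertion {x} {w} bx <v w! m∈ F =
    +-cancelʳ-≡ (1 * F (suc k)) _ _ (begin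
      Σins (F ∘ stat x) v w + 1 * F (suc k)
        ≡⟨ cong (λ c → Σins (F ∘ stat x) v w + (𝟙 c + 1) * F (suc k)) bx ⟨
      Σins (F ∘ stat x) v w + (𝟙 (b x) + 1) * F (suc k)
        ≡⟨ until-marker <v w! m∈ F ⟩
      (k + (𝟙 (b x) + 1)) * F k + suc (adjacencies R̄ x w) * F (suc k)
        ≡⟨ cong₂ (λ c e → (k + (𝟙 c + 1)) * F k + suc e * F (suc k))
             bx (adjacencies-complement R x w) ⟩
      (k + 1) * F k + suc (length w ∸ k) * F (suc k)
        ≡⟨ p k (length w ∸ k) (F k) (F (suc k)) ⟩
      suc k * F k + (length w ∸ k) * F (suc k) + 1 * F (suc k) ∎)
    where
    open ≡-Reasoning
    k = adjacencies R x w
    p : ∀ k e x y → (k + 1) * x + suc e * y ≡ suc k * x + e * y + 1 * y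
    p = solve-∀

-- Big ascents and level ascents as instances

bigAscentᵇ : ℕ → ℕ → Bool
bigAscentᵇ x y = does (2 + x ≤? y)

bigAscents : List ℕ → ℕ
bigAscents = adjacencies bigAscentᵇ 0

-- Built from the same deciders as `ldesPair?`, so that the two agree by `refl` once levels and
-- labels are rewritten.
lexᵇ : ℕ → ℕ → ℕ → ℕ → Bool
lexᵇ d e x y = does ((d <? e) ⊎-dec ((d ≟ e) ×-dec (y <? x)))

byLevel : (ℕ → ℕ) → ℕ → ℕ → Bool
byLevel D x y = lexᵇ (D x) (D y) x y

-- levels par w n z is des(z) for the tree on 0, …, n in which par k is the parent of k + 1, and the
-- permutation whose inverse is the word w. It is computed by attaching the leaves 1, …, n in turn.
levels : (ℕ → ℕ) → List ℕ → ℕ → ℕ → ℕ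
levels par w zero    z = 0
levels par w (suc n) z =
  if z ≡ᵇ suc n then levels par w n (par n) + 𝟙 (before (suc n) (par n) w) else levels par w n z

levelAscents : (ℕ → ℕ) → ℕ → List ℕ → ℕ
levelAscents par n w = adjacencies (byLevel (levels par (0 ∷ w) n)) 0 w

levels-0 : ∀ par w n → levels par w n 0 ≡ 0
levels-0 par w zero    = refl
levels-0 par w (suc n) = levels-0 par w n

-- Used to see that inserting `n + 1`, which leaves the relative order of `0, …, n` alone, changes
-- no earlier level.
levels-cong : ∀ {par} → (∀ k → par k ≤ k) → ∀ {w w′} n →
           (∀ {i j} → i ≤ n → j ≤ n → before i j w ≡ before i j w′) →
           levels par w n ≗ levels par w′ n
levels-cong par≤ zero    same z = refl
levels-cong par≤ (suc n) same z = cong₂ (λ d e → if z ≡ᵇ suc n then d else e)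
  (cong₂ (λ d b → d + 𝟙 b) (ih _) (same ≤-refl (m≤n⇒m≤1+n (par≤ n)))) (ih z)
  where ih = levels-cong par≤ n λ i≤ j≤ → same (m≤n⇒m≤1+n i≤) (m≤n⇒m≤1+n j≤)

before-++-∷ : ∀ {v i j} → v ≢ i → v ≢ j → ∀ xs {ys} →
              before i j (xs ++ v ∷ ys) ≡ before i j (xs ++ ys)
before-++-∷ {v} {i} {j} v≢i v≢j [] rewrite dec-false (v ≟ i) v≢i | dec-false (v ≟ j) v≢j = refl
before-++-∷ {v} {i} {j} v≢i v≢j (x ∷ xs) =
  cong (λ b → (x ≡ᵇ i) ∨ (not (x ≡ᵇ j) ∧ b)) (before-++-∷ v≢i v≢j xs)

does-true⁻ : ∀ {p} {A : Set p} (a? : Dec A) → does a? ≡ true → A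
does-true⁻ (yes a) _ = a

does-false⁻ : ∀ {p} {A : Set p} (a? : Dec A) → does a? ≡ false → ¬ A
does-false⁻ (no ¬a) _ = ¬a

-- The inserted letter has the largest label, so a tie counts when it comes first (`lexᵇ-<`) and
-- does not when it comes second. Either way, the letters ranking above it are those of at least its
-- level.
lexᵇ-≥ : ∀ d e {x y} → x ≤ y → lexᵇ d e x y ≡ not (does (e ≤? d))
lexᵇ-≥ d e {x} {y} x≤y =
  does-⇔ (mk⇔ to (inj₁ ∘ ≰⇒>)) ((d <? e) ⊎-dec ((d ≟ e) ×-dec (y <? x))) (¬? (e ≤? d))
  where
  to : d < e ⊎ (d ≡ e × y < x) → ¬ e ≤ d
  to (inj₁ d<e)       = <⇒≱ d<e
  to (inj₂ (_ , y<x)) = contradiction x≤y (<⇒≱ y<x)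

lexᵇ-< : ∀ d e {x y} → y < x → lexᵇ d e x y ≡ does (d ≤? e)
lexᵇ-< d e {x} {y} y<x = does-⇔ (mk⇔ to from) ((d <? e) ⊎-dec ((d ≟ e) ×-dec (y <? x))) (d ≤? e)
  where
  to : d < e ⊎ (d ≡ e × y < x) → d ≤ e
  to (inj₁ d<e)       = <⇒≤ d<e
  to (inj₂ (d≡e , _)) = ≤-reflexive d≡e
  from : d ≤ e → d < e ⊎ (d ≡ e × y < x)
  from d≤e with m≤n⇒m<n∨m≡n d≤e
  ... | inj₁ d<e = inj₁ d<e
  ... | inj₂ d≡e = inj₂ (d≡e , y<x)

module _ {n w} (<v : All (_< suc n) (0 ∷ w)) (w! : Unique (0 ∷ w))
  (covers : ∀ {k} → k ≤ n → k ∈ 0 ∷ w) where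

  -- The marker is `n`. The letter `n + 1` behaves as the top rank, except that `n` followed by
  -- `n + 1` is no big ascent: seen from behind, `n` acts as if it ranked above. In front of `n` no
  -- exception occurs, as a step from `n + 1` to `n` is a fall.
  bigAscents-insertion : ∀ F → let k = bigAscents w in
    Σins (F ∘ bigAscents) (suc n) w ≡ suc k * F k + (length w ∸ k) * F (suc k)
  bigAscents-insertion F = trans
    (Σins-cong (suc n) w λ xs _ → cong F (sym (stat-const (xs ++ _))))
    (insertion refl <v w! (covers ≤-refl) F)
    where
    a : ℕ → Bool
    a x = does (n ≟ x)
    v-above : ∀ {y} → y < suc n → bigAscentᵇ (suc n) y ≡ false
    v-above {y} y<v = dec-false (3 + n ≤? y) λ 3+n≤y → <⇒≱ y<v (≤-trans (m≤n+m (suc n) 2) 3+n≤y)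
    below-v : ∀ {x} → x < suc n → bigAscentᵇ x (suc n) ≡ not (a x)
    below-v {x} x<v = does-⇔ (mk⇔ to from) (2 + x ≤? suc n) (¬? (n ≟ x))
      where
      to : 2 + x ≤ suc n → n ≢ x
      to 2+x≤v n≡x = 1+n≰n (≤-trans (≤-reflexive (cong (2 +_) n≡x)) 2+x≤v)
      from : n ≢ x → 2 + x ≤ suc n
      from n≢x = s≤s (≤∧≢⇒< (s≤s⁻¹ x<v) (n≢x ∘ sym))
    open Insertion (suc n) n ≤-refl bigAscentᵇ bigAscentᵇ bigAscentᵇ (λ _ → false) a
      (λ _ _ → refl)
      (λ {x} x<v x≢n → dec-true (2 + x ≤? suc n) (s≤s (≤∧≢⇒< (s≤s⁻¹ x<v) x≢n)))
      v-above
      (λ _ _ _ ())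
      (λ _ _ ())
      refl
      (λ _ _ → refl)
      below-v
      (λ {y} y<v n≢y → trans (v-above y<v) (sym (dec-false (n ≟ y) n≢y)))
      (λ {x} {y} _ _ n≢y _ ay → contradiction (does-true⁻ (n ≟ y) ay) n≢y)
      (λ {x} {y} _ y<v _ ax _ → dec-false (2 + x ≤? y) λ 2+x≤y →
        <⇒≱ y<v (≤-trans (≤-reflexive (cong suc (does-true⁻ (n ≟ x) ax)))
                         (≤-trans (n≤1+n _) 2+x≤y)))
      (dec-true (n ≟ n) refl)
    stat-const : ∀ u → stat 0 u ≡ bigAscents u
    stat-const u with before (suc n) n (0 ∷ u)
    ... | true  = refl
    ... | false = refl

  -- The marker is the parent of `n + 1`, of level `L`. Placed before it the new letter gets level
  -- `L + 1`, after it `L`, so the parent ranks below the new letter in the first case and above it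
  -- in the second.
  levelAscents-insertion : ∀ {par} → (∀ k → par k ≤ k) → ∀ F → let k = levelAscents par n w in
    Σins (F ∘ levelAscents par (suc n)) (suc n) w ≡ suc k * F k + (length w ∸ k) * F (suc k)
  levelAscents-insertion {par} par≤ F = trans
    (Σins-cong (suc n) w λ xs eq → cong F (levelAscents≡stat xs eq))
    -- The initial letter `0` has level 0, which is less than `L + 1`.
    (insertion (dec-false (L + 1 ≤? D 0) λ L<D0 →
        1+n≰n (≤-trans (m≤n+m 1 L) (≤-trans L<D0 (≤-reflexive (levels-0 par (0 ∷ w) n)))))
      <v w! (covers (par≤ n)) F)
    where
    v = suc n
    p = par n
    D = levels par (0 ∷ w) n
    L = D p
    E : ℕ → ℕ → ℕ
    E ℓ z = if z ≡ᵇ v then ℓ else D z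
    above : ℕ → ℕ → Bool
    above ℓ z = does (ℓ ≤? D z)
    E-old : ∀ ℓ {x} → x < v → E ℓ x ≡ D x
    E-old ℓ {x} x<v rewrite dec-false (x ≟ v) (<⇒≢ x<v) = refl
    E-new : ∀ ℓ → E ℓ v ≡ ℓ
    E-new ℓ rewrite dec-true (v ≟ v) refl = refl
    old : ∀ ℓ {x y} → x < v → y < v → byLevel (E ℓ) x y ≡ byLevel D x y
    old ℓ {x} {y} x<v y<v = cong₂ (λ d e → lexᵇ d e x y) (E-old ℓ x<v) (E-old ℓ y<v)
    to : ∀ ℓ {x} → x < v → byLevel (E ℓ) x v ≡ not (above ℓ x)
    to ℓ {x} x<v = trans
      (cong₂ (λ d e → lexᵇ d e x v) (E-old ℓ x<v) (E-new ℓ)) (lexᵇ-≥ (D x) ℓ (<⇒≤ x<v))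
    from : ∀ ℓ {y} → y < v → byLevel (E ℓ) v y ≡ above ℓ y
    from ℓ {y} y<v = trans
      (cong₂ (λ d e → lexᵇ d e v y) (E-new ℓ) (E-old ℓ y<v)) (lexᵇ-< ℓ (D y) y<v)
    up : ∀ ℓ {x y} → above ℓ x ≡ false → above ℓ y ≡ true → byLevel D x y ≡ true
    up ℓ {x} {y} ax ay = dec-true ((D x <? D y) ⊎-dec ((D x ≟ D y) ×-dec (y <? x)))
      (inj₁ (<-≤-trans (≰⇒> (does-false⁻ (ℓ ≤? D x) ax)) (does-true⁻ (ℓ ≤? D y) ay)))
    down : ∀ ℓ {x y} → above ℓ x ≡ true → above ℓ y ≡ false → byLevel D x y ≡ false
    down ℓ {x} {y} ax ay = dec-false ((D x <? D y) ⊎-dec ((D x ≟ D y) ×-dec (y <? x)))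
      λ { (inj₁ lt) → <⇒≱ lt (<⇒≤ gt) ; (inj₂ (eq , _)) → <⇒≢ gt (sym eq) }
      where
      gt : D y < D x
      gt = <-≤-trans (≰⇒> (does-false⁻ (ℓ ≤? D y) ay)) (does-true⁻ (ℓ ≤? D x) ax)
    -- `L + 1` and `L + 0` are the values of `L + 𝟙 c`, which lets `if-float` hold by `refl`.
    open Insertion v p (s≤s (par≤ n)) (byLevel D)
      (byLevel (E (L + 1))) (byLevel (E (L + 0))) (above (L + 1)) (above (L + 0))
      (old (L + 1)) (λ x<v _ → to (L + 1) x<v) (from (L + 1))
      (λ _ _ → up (L + 1)) (λ _ _ → down (L + 1))
      (dec-false (L + 1 ≤? L) λ le → 1+n≰n (≤-trans (≤-reflexive (+-comm 1 L)) le))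
      (old (L + 0)) (to (L + 0)) (λ y<v _ → from (L + 0) y<v)
      (λ _ _ _ → up (L + 0)) (λ _ _ _ → down (L + 0))
      (dec-true (L + 0 ≤? L) (≤-reflexive (+-identityʳ L)))
    levelAscents≡stat : ∀ xs {ys} → xs ++ ys ≡ w →
                        let u = xs ++ v ∷ ys in levelAscents par v u ≡ stat 0 u
    levelAscents≡stat xs {ys} refl = trans
      (adjacencies-cong (λ {x} {y} _ _ → cong₂ (λ d e → lexᵇ d e x y) (levels≗E x) (levels≗E y))
                        {0} {u} (All.universal-U _))
      (if-float (before v p (0 ∷ u)))
      where
      u = xs ++ v ∷ ys
      ℓ = L + 𝟙 (before v p (0 ∷ u))
      levels≗ : levels par (0 ∷ u) n ≗ D
      levels≗ = levels-cong par≤ n λ i≤n j≤n → before-++-∷ (>⇒≢ (s≤s i≤n)) (>⇒≢ (s≤s j≤n)) (0 ∷ xs)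
      levels≗E : levels par (0 ∷ u) v ≗ E ℓ
      levels≗E z = cong₂ (λ d e → if z ≡ᵇ v then d + 𝟙 (before v p (0 ∷ u)) else e)
        (levels≗ p) (levels≗ z)
      if-float : ∀ c → adjacencies (byLevel (E (L + 𝟙 c))) 0 u ≡
                       adjacencies (if c then byLevel (E (L + 1)) else byLevel (E (L + 0))) 0 u
      if-float true  = refl
      if-float false = refl

-- Reindexing sums over lists

module _ {a ℓ} {A : Set a} {_~_ : Rel A ℓ} (~-sym : Symmetric _~_) (~-trans : Transitive _~_)
  (f : A → ℕ) (f-resp : ∀ {x y} → x ~ y → f x ≡ f y) where

  -- Removes one match of `x`. Entries inequivalent to `x` keep their matches, which lets
  -- `sum-reindex` recurse.
  extract : ∀ {x ys} → Any (x ~_) ys → ∃[ zs ]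
    sum (map f ys) ≡ f x + sum (map f zs) × length ys ≡ suc (length zs) ×
    (∀ {z} → ¬ x ~ z → Any (z ~_) ys → Any (z ~_) zs)
  extract {x} {y ∷ ys} (here x~y) = ys , cong (_+ sum (map f ys)) (sym (f-resp x~y)) , refl , keep
    where
    keep : ∀ {z} → ¬ x ~ z → Any (z ~_) (y ∷ ys) → Any (z ~_) ys
    keep x≁z (here z~y) = contradiction (~-trans x~y (~-sym z~y)) x≁z
    keep x≁z (there p)  = p
  extract {x} {y ∷ ys} (there x∈) with extract x∈
  ... | zs , eq , len , keep =
    y ∷ zs , trans (cong (f y +_) eq) (exchange (f y) (f x) _) , cong suc len , keep′
    where
    exchange : ∀ a b c → a + (b + c) ≡ b + (a + c)
    exchange = solve-∀
    keep′ : ∀ {z} → ¬ x ~ z → Any (z ~_) (y ∷ ys) → Any (z ~_) (y ∷ zs)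
    keep′ x≁z (here z~y) = here z~y
    keep′ x≁z (there p)  = there (keep x≁z p)

  -- Pigeonhole: pairwise inequivalent entries use up different matches in `ys`, and equal lengths
  -- leave nothing over.
  sum-reindex : ∀ {xs ys} → AllPairs (λ x y → ¬ x ~ y) xs → All (λ x → Any (x ~_) ys) xs →
                length xs ≡ length ys → sum (map f xs) ≡ sum (map f ys)
  sum-reindex {[]}     {[]}     _ _ _ = refl
  sum-reindex {x ∷ xs} {ys} (x≁ ∷ xs!) (x∈ ∷ xs⊆) len with extract x∈
  ... | zs , eq , len′ , keep = trans
    (cong (f x +_) (sum-reindex xs! (All.zipWith (λ (x≁z , z∈) → keep x≁z z∈) (x≁ , xs⊆))
                                    (suc-injective (trans len len′))))
    (sym eq)

length-cartesianProductWith : ∀ {a b c} {A : Set a} {B : Set b} {C : Set c} (g : A → B → C) xs ys →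
                              length (cartesianProductWith g xs ys) ≡ length xs * length ys
length-cartesianProductWith g []       ys = refl
length-cartesianProductWith g (x ∷ xs) ys = trans (length-++ (map (g x) ys))
  (cong₂ _+_ (length-map (g x) ys) (length-cartesianProductWith g xs ys))

sum-cartesianProductWith : ∀ {a b c} {A : Set a} {B : Set b} {C : Set c}
                           (f : C → ℕ) (g : A → B → C) xs ys →
  sum (map f (cartesianProductWith g xs ys)) ≡ sum (map (λ x → sum (map (f ∘ g x) ys)) xs)
sum-cartesianProductWith f g []       ys = refl
sum-cartesianProductWith f g (x ∷ xs) ys = begin
  sum (map f (map (g x) ys ++ cartesianProductWith g xs ys))
    ≡⟨ cong sum (map-++ f (map (g x) ys) _) ⟩
  sum (map f (map (g x) ys) ++ map f (cartesianProductWith g xs ys))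
    ≡⟨ sum-++ (map f (map (g x) ys)) _ ⟩
  sum (map f (map (g x) ys)) + sum (map f (cartesianProductWith g xs ys))
    ≡⟨ cong₂ _+_ (cong sum (sym (map-∘ ys))) (sum-cartesianProductWith f g xs ys) ⟩
  sum (map (f ∘ g x) ys) + sum (map (λ x → sum (map (f ∘ g x) ys)) xs) ∎
  where open ≡-Reasoning

-- Sums over permutations and their words

Σ𝔖 : ∀ n → (Permutation′ n → ℕ) → ℕ
Σ𝔖 n f = sum (map f (𝔖 n))

Σ𝔖-cong : ∀ n {f g : Permutation′ n → ℕ} → f ≗ g → Σ𝔖 n f ≡ Σ𝔖 n g
Σ𝔖-cong n f≗g = cong sum (map-cong f≗g (𝔖 n))

Σ𝔖-reindex : ∀ {n} (f : Permutation′ n → ℕ) → (∀ {π ρ} → π ≈ ρ → f π ≡ f ρ) → ∀ {πs} →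
             (∀ π → Any (π ≈_) πs) → length (𝔖 n) ≡ length πs → Σ𝔖 n f ≡ sum (map f πs)
Σ𝔖-reindex {n} f f-resp complete =
  sum-reindex {_~_ = _≈_} (λ p i → sym (p i)) (λ p q i → trans (p i) (q i))
    f (λ {π} {ρ} → f-resp {π} {ρ}) (𝔖-distinct n) (All.universal complete (𝔖 n))

Σ𝔖-flip : ∀ n (f : Permutation′ n → ℕ) → (∀ {π ρ} → π ≈ ρ → f π ≡ f ρ) → Σ𝔖 n f ≡ Σ𝔖 n (f ∘ flip)
Σ𝔖-flip n f f-resp = trans
  (Σ𝔖-reindex f (λ {π} {ρ} → f-resp {π} {ρ}) complete (sym (length-map flip (𝔖 n))))
  (cong sum (sym (map-∘ (𝔖 n))))
  where
  complete : ∀ π → Any (π ≈_) (map flip (𝔖 n))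
  complete π = Any.map⁺ (Any.map (λ {ρ} π⁻¹≈ρ i → trans (sym (inverseˡ ρ))
    (cong (ρ ⟨$⟩ˡ_) (trans (sym (π⁻¹≈ρ (π ⟨$⟩ʳ i))) (inverseˡ π)))) (𝔖-complete (flip π)))

word : ∀ {n} → Permutation′ n → List ℕ
word π = tabulate (suc ∘ toℕ ∘ (π ⟨$⟩ʳ_))

word-cong : ∀ {n} {π ρ : Permutation′ n} → π ≈ ρ → word π ≡ word ρ
word-cong π≈ρ = tabulate-cong (cong (suc ∘ toℕ) ∘ π≈ρ)

insert-lookup : ∀ {m n} i j (π : Permutation m n) → insert i j π ⟨$⟩ʳ i ≡ j
insert-lookup i j π with i Fin.≟ i
... | yes _  = refl
... | no i≢i = contradiction refl i≢i

punchIn-fromℕ : ∀ {n} (i : Fin n) → toℕ (punchIn (fromℕ n) i) ≡ toℕ i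
punchIn-fromℕ {suc n} zero    = refl
punchIn-fromℕ {suc n} (suc i) = cong suc (punchIn-fromℕ i)

word-insert : ∀ {n} j (π : Permutation′ n) →
  word (insert j (fromℕ n) π) ≡ tabulate (insertAt (suc ∘ toℕ ∘ (π ⟨$⟩ʳ_)) j (suc n))
word-insert {n} j π = tabulate-cong eq
  where
  g : Fin n → ℕ
  g = suc ∘ toℕ ∘ (π ⟨$⟩ʳ_)
  eq : suc ∘ toℕ ∘ (insert j (fromℕ n) π ⟨$⟩ʳ_) ≗ insertAt g j (suc n)
  eq i with j Fin.≟ i
  ... | yes refl = trans (cong suc (Fin.toℕ-fromℕ n)) (sym (insertAt-lookup g j (suc n)))
  ... | no j≢i  = trans (cong suc (punchIn-fromℕ (π ⟨$⟩ʳ punchOut j≢i)))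
    (trans (sym (insertAt-punchIn g j (suc n) (punchOut j≢i)))
           (cong (insertAt g j (suc n)) (Fin.punchIn-punchOut j≢i)))

Σins-tabulate : ∀ {n} (G : List ℕ → ℕ) (g : Fin n → ℕ) v →
                sum (tabulate λ j → G (tabulate (insertAt g j v))) ≡ Σins G v (tabulate g)
Σins-tabulate {zero}  G g v = +-identityʳ _
Σins-tabulate {suc n} G g v =
  cong (G (v ∷ tabulate g) +_) (Σins-tabulate (G ∘ (g zero ∷_)) (g ∘ suc) v)

-- `𝔖` chooses the first letter, whereas the induction chooses the position of the largest one. The
-- second list is also complete and has the same length, so the sums agree.
Σ𝔖-suc : ∀ n (G : List ℕ → ℕ) → Σ𝔖 (suc n) (G ∘ word) ≡ Σ𝔖 n (λ π → Σins G (suc n) (word π))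
Σ𝔖-suc n G = begin
  Σ𝔖 (suc n) (G ∘ word)
    ≡⟨ Σ𝔖-reindex (G ∘ word) (λ {π} {ρ} π≈ρ → cong G (word-cong {π = π} {ρ} π≈ρ)) complete len ⟩
  sum (map (G ∘ word) (cartesianProductWith ins (𝔖 n) (allFin (suc n))))
    ≡⟨ sum-cartesianProductWith (G ∘ word) ins (𝔖 n) (allFin (suc n)) ⟩
  Σ𝔖 n (λ π → sum (map (G ∘ word ∘ ins π) (allFin (suc n))))
    ≡⟨ Σ𝔖-cong n (λ π → trans
         (cong sum (trans (map-tabulate id (G ∘ word ∘ ins π))
                          (tabulate-cong λ j → cong G (word-insert j π))))
         (Σins-tabulate G (suc ∘ toℕ ∘ (π ⟨$⟩ʳ_)) (suc n))) ⟩
  Σ𝔖 n (λ π → Σins G (suc n) (word π)) ∎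
  where
  open ≡-Reasoning
  ins : Permutation′ n → Fin (suc n) → Permutation′ (suc n)
  ins π j = insert j (fromℕ n) π
  ins-cong : ∀ {j} {π ρ : Permutation′ n} → π ≈ ρ → ins π j ≈ ins ρ j
  ins-cong {j} π≈ρ i with j Fin.≟ i
  ... | yes _   = refl
  ... | no j≢i = cong (punchIn (fromℕ n)) (π≈ρ (punchOut j≢i))
  len : length (𝔖 (suc n)) ≡ length (cartesianProductWith ins (𝔖 n) (allFin (suc n)))
  len = trans (length-cartesianProductWith (insert zero) (allFin (suc n)) (𝔖 n))
    (trans (*-comm (length (allFin (suc n))) _)
           (sym (length-cartesianProductWith ins (𝔖 n) (allFin (suc n)))))
  complete : ∀ π → Any (π ≈_) (cartesianProductWith ins (𝔖 n) (allFin (suc n)))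
  complete π = Any.cartesianProductWith⁺ ins
    (λ { {ρ} {j} rem≈ρ refl i → trans (sym (insert-remove j π i))
         (trans (cong (λ l → insert j l (remove j π) ⟨$⟩ʳ i) (inverseʳ π))
                (ins-cong {j} {remove j π} {ρ} rem≈ρ i)) })
    (𝔖-complete (remove (π ⟨$⟩ˡ fromℕ n) π)) (∈-allFin (π ⟨$⟩ˡ fromℕ n))

⟨⟩-injective : ∀ {n} (π : Permutation′ n) {i j} → π ⟨ i ⟩ ≡ π ⟨ j ⟩ → i ≡ j
⟨⟩-injective π eq =
  trans (sym (inverseˡ (lift₀ π))) (trans (cong (lift₀ π ⟨$⟩ˡ_) eq) (inverseˡ (lift₀ π)))

module _ {n} (π : Permutation′ n) where

  private
    values : Fin (suc n) → ℕ
    values i = toℕ (π ⟨ i ⟩)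

  word-bounded : All (_< suc n) (0 ∷ word π)
  word-bounded = All.tabulate⁺ {f = values} λ i → Fin.toℕ<n (π ⟨ i ⟩)

  word-unique : Unique (0 ∷ word π)
  word-unique = Unique.tabulate⁺ {f = values} (⟨⟩-injective π ∘ Fin.toℕ-injective)

  word-covers : ∀ {k} → k ≤ n → k ∈ 0 ∷ word π
  word-covers {k} k≤n = subst (_∈ 0 ∷ word π)
    (trans (cong toℕ (inverseʳ (lift₀ π))) (Fin.toℕ-fromℕ< (s≤s k≤n)))
    (∈-tabulate⁺ {f = values} (lift₀ π ⟨$⟩ˡ fromℕ< (s≤s k≤n)))

-- Summing over the positions of the largest letter turns the weight `F` into the same `F′` for both
-- statistics; the induction hypothesis is applied to `F′`.
equidistribution : ∀ n {par} → (∀ k → par k ≤ k) → ∀ (F : ℕ → ℕ) →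
  Σ𝔖 n (F ∘ levelAscents par n ∘ word) ≡ Σ𝔖 n (F ∘ bigAscents ∘ word)
equidistribution zero          par≤ F = refl
equidistribution (suc n) {par} par≤ F = begin
  Σ𝔖 (suc n) (F ∘ levelAscents par (suc n) ∘ word)
    ≡⟨ Σ𝔖-suc n (F ∘ levelAscents par (suc n)) ⟩
  Σ𝔖 n (λ π → Σins (F ∘ levelAscents par (suc n)) (suc n) (word π))
    ≡⟨ Σ𝔖-cong n (λ π → trans
         (levelAscents-insertion (word-bounded π) (word-unique π) (word-covers π) par≤ F)
         (len π _)) ⟩
  Σ𝔖 n (F′ ∘ levelAscents par n ∘ word)
    ≡⟨ equidistribution n par≤ F′ ⟩
  Σ𝔖 n (F′ ∘ bigAscents ∘ word)
    ≡⟨ Σ𝔖-cong n (λ π → trans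
         (bigAscents-insertion (word-bounded π) (word-unique π) (word-covers π) F) (len π _)) ⟨
  Σ𝔖 n (λ π → Σins (F ∘ bigAscents) (suc n) (word π))
    ≡⟨ Σ𝔖-suc n (F ∘ bigAscents) ⟨
  Σ𝔖 (suc n) (F ∘ bigAscents ∘ word) ∎
  where
  open ≡-Reasoning
  F′ : ℕ → ℕ
  F′ k = suc k * F k + (n ∸ k) * F (suc k)
  len : ∀ π k → suc k * F k + (length (word π) ∸ k) * F (suc k) ≡ F′ k
  len π k =
    cong (λ l → suc k * F k + (l ∸ k) * F (suc k)) (length-tabulate (suc ∘ toℕ ∘ (π ⟨$⟩ʳ_)))

-- Evaluating levels and positions

levels-stable : ∀ par w n {z} → z ≤ n → levels par w (suc n) z ≡ levels par w n z
levels-stable par w n {z} le rewrite dec-false (z ≟ suc n) (<⇒≢ (s≤s le)) = refl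

levels-suc : ∀ {par} → (∀ k → par k ≤ k) → ∀ w n {k} → k < n →
          levels par w n (suc k) ≡ levels par w n (par k) + 𝟙 (before (suc k) (par k) w)
levels-suc {par} par≤ w (suc n) {k} k<1+n with k ≟ n
... | yes refl rewrite dec-true (k ≟ k) refl =
  cong (_+ 𝟙 (before (suc k) (par k) w)) (sym (levels-stable par w k (par≤ k)))
... | no k≢n = trans (levels-stable par w n k<n) (trans (levels-suc par≤ w n k<n)
  (cong (_+ 𝟙 (before (suc k) (par k) w))
        (sym (levels-stable par w n (≤-trans (par≤ k) (<⇒≤ k<n))))))
  where
  k<n : k < n
  k<n = ≤∧≢⇒< (s≤s⁻¹ k<1+n) k≢n

before-tabulate : ∀ {n} {f : Fin n → ℕ} → (∀ {i j} → f i ≡ f j → i ≡ j) →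
                  ∀ i j → i ≢ j → before (f i) (f j) (tabulate f) ≡ does (i Fin.<? j)
before-tabulate         f-inj zero    zero    i≢j = contradiction refl i≢j
before-tabulate {f = f} f-inj zero    (suc j) i≢j rewrite dec-true (f zero ≟ f zero) refl = refl
before-tabulate {f = f} f-inj (suc i) zero    i≢j
  rewrite dec-true (f zero ≟ f zero) refl
        | dec-false (f zero ≟ f (suc i)) (λ eq → i≢j (sym (f-inj eq))) = refl
before-tabulate {f = f} f-inj (suc i) (suc j) i≢j
  rewrite dec-false (f zero ≟ f (suc i)) (λ eq → Fin.0≢1+n (f-inj eq))
        | dec-false (f zero ≟ f (suc j)) (λ eq → Fin.0≢1+n (f-inj eq)) =
  before-tabulate (Fin.suc-injective ∘ f-inj) i j (i≢j ∘ cong suc)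

-- Auxiliary facts on paths, lists and double sums

last-step : ∀ {a ℓ} {A : Set a} {R : Rel A ℓ} {x y z} → R x y → Star R y z → ∃[ u ] R u z
last-step r ε        = _ , r
last-step _ (r ◅ rs) = last-step r rs

length-∷ʳ : ∀ {a} {A : Set a} (x : A) xs → length (xs ∷ʳ x) ≡ suc (length xs)
length-∷ʳ x xs = trans (length-++ xs) (+-comm (length xs) 1)

Linked-∷ʳ : ∀ {a ℓ} {A : Set a} {R : Rel A ℓ} xs {y z} →
            Linked R (xs ∷ʳ y) → R y z → Linked R (xs ∷ʳ y ∷ʳ z)
Linked-∷ʳ []           [-]      r = r ∷ [-]
Linked-∷ʳ (x ∷ [])     (q ∷ qs) r = q ∷ Linked-∷ʳ [] qs r
Linked-∷ʳ (x ∷ y ∷ xs) (q ∷ qs) r = q ∷ Linked-∷ʳ (y ∷ xs) qs r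

AllPairs-∷ʳ : ∀ {a ℓ} {A : Set a} {R : Rel A ℓ} {xs y} →
              AllPairs R xs → All (λ x → R x y) xs → AllPairs R (xs ∷ʳ y)
AllPairs-∷ʳ []         []         = [] ∷ []
AllPairs-∷ʳ (px ∷ pxs) (rx ∷ rxs) = All.∷ʳ⁺ px rx ∷ AllPairs-∷ʳ pxs rxs

length-filter≡sum : ∀ {a p} {A : Set a} {Q : A → Set p} (Q? : Decidable Q) xs →
                    length (filter Q? xs) ≡ sum (map (𝟙 ∘ does ∘ Q?) xs)
length-filter≡sum Q? []       = refl
length-filter≡sum Q? (x ∷ xs) with does (Q? x)
... | true  = cong suc (length-filter≡sum Q? xs)
... | false = length-filter≡sum Q? xs

sum-tabulate : ∀ {n} (f : Fin n → ℕ) → sum (tabulate f) ≡ ∑[ i < n ] f i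
sum-tabulate {zero}  f = refl
sum-tabulate {suc n} f = cong (f zero +_) (sum-tabulate (f ∘ suc))

adjacencies-tabulate : ∀ {n} R (f : Fin (suc n) → ℕ) →
  adjacencies R (f zero) (tabulate (f ∘ suc)) ≡
  sum (tabulate λ i → 𝟙 (R (f (inject₁ i)) (f (suc i))))
adjacencies-tabulate {zero}  R f = refl
adjacencies-tabulate {suc n} R f =
  cong (𝟙 (R (f zero) (f (suc zero))) +_) (adjacencies-tabulate R (f ∘ suc))

consecutive : ∀ {n} → Fin n → Fin n → Bool
consecutive i j = suc (toℕ i) ≡ᵇ toℕ j

-- Row zero contributes only its entry in column one, and the other rows vanish in column zero, so
-- removing both leaves the same sum for the shorter word.
adjacencies-consecutive : ∀ {n} R (f : Fin (suc n) → ℕ) →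
  ∑[ i ≤ n ] ∑[ j ≤ n ] 𝟙 (consecutive i j ∧ R (f i) (f j)) ≡
  adjacencies R (f zero) (tabulate (f ∘ suc))
adjacencies-consecutive {zero}  R f = refl
adjacencies-consecutive {suc n} R f = cong₂ _+_
  (trans (cong (𝟙 (R (f zero) (f (suc zero))) +_) (sum-replicate-zero n)) (+-identityʳ _))
  (adjacencies-consecutive R (f ∘ suc))

-- Labels and lower covers

module _ {n ℓ} (P : NaturallyLabeledPoset n ℓ) where

  open NaturallyLabeledPoset P using (_≺_; natural)

  label-⋖̌ : ∀ {x a} → _⋖̌_ P x (ι a) → label P x Fin.< suc a
  label-⋖̌ {⊥₋}  _                                   = s≤s z≤n
  label-⋖̌ {ι b} ((Infimum.[ b≼a ] , b≢a) , _) = s≤s (natural (b≼a , b≢a ∘ cong ι))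

  label-injective : ∀ {x y} → label P x ≡ label P y → x ≡ y
  label-injective {⊥₋}  {⊥₋}  _    = refl
  label-injective {ι a} {ι a} refl = refl

  unlabel : Fin (suc n) → P̌ P
  unlabel zero    = ⊥₋
  unlabel (suc a) = ι a

  label-unlabel : ∀ i → label P (unlabel i) ≡ i
  label-unlabel zero    = refl
  label-unlabel (suc a) = refl

  sum-P̌-elements : ∀ f → sum (map f (P̌-elements P)) ≡ ∑[ i ≤ n ] f (unlabel i)
  sum-P̌-elements f = trans
    (cong (λ xs → f ⊥₋ + sum (map f xs)) (map-tabulate id ι))
    (trans (cong (λ xs → f ⊥₋ + sum xs) (map-tabulate ι f)) (cong (f ⊥₋ +_) (sum-tabulate (f ∘ ι))))

  ι-mono : ∀ {a b} → a ≺ b → _≺̌_ P (ι a) (ι b)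
  ι-mono (a≼b , a≢b) = Infimum.[ a≼b ] , λ { refl → a≢b refl }

  lower-cover : ∀ a → ∃[ x ] _⋖̌_ P x (ι a)
  lower-cover a with saturatedChain P (ι a)
  ... | r ◅ rs = last-step r rs

-- Unique lower covers in a rooted tree

module _ {n ℓ} {P : NaturallyLabeledPoset n ℓ}
  (isRootedTree : NaturallyLabeledPoset.IsRootedTree P) where

  open NaturallyLabeledPoset P hiding (IsRootedTree)
  open NaturallyLabeledPoset.IsRootedTree isRootedTree
  open Graph Hasse using (Cycle; module IsTree)
  open IsTree hasseTree using (acyclic)

  ⋖̌⇒⋖ : ∀ {a b} → _⋖̌_ P (ι a) (ι b) → a ⋖ b
  ⋖̌⇒⋖ ((Infimum.[ a≼b ] , a≢b) , ¬between) =
    (a≼b , a≢b ∘ cong ι) , λ (z , a≺z , z≺b) → ¬between (ι z , ι-mono P a≺z , ι-mono P z≺b)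

  -- By naturality nothing lies below `zero`, so `zero` is the unique minimal element.
  minimal-least : ∀ {a b : Fin n} → Minimal b → ¬ a Fin.< b
  minimal-least {zero}  {b} b-min 0<b = >⇒≢ 0<b (cong toℕ (trans (sym (root≡ b-min)) (root≡ 0-min)))
    where
    root≡ : ∀ {c} → Minimal c → proj₁ uniqueMinimal ≡ c
    root≡ = proj₂ (proj₂ uniqueMinimal)
    0-min : Minimal zero
    0-min y y≺0 with () ← natural y≺0
  minimal-least {suc a} {b} b-min a<b = minimal-least {zero} b-min (≤-trans (s≤s z≤n) a<b)

  -- If `⊥₋` were the lower cover of `b`, then `b` would be minimal in spite of the smaller label
  -- `a`.
  descend : ∀ {a b} → a Fin.< b → ∃[ c ] c ⋖ b
  descend {b = b} a<b with lower-cover P b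
  ... | ι c , c⋖b           = c , ⋖̌⇒⋖ c⋖b
  ... | ⊥₋ , (_ , ¬between) = contradiction a<b
    (minimal-least λ y y≺b → ¬between (ι y , ((⊥₋≤ ι y) , λ ()) , ι-mono P y≺b))

  -- The endpoints of a simple path all of whose interior vertices have larger labels
  -- can be pushed down alternately until they meet, which closes a cycle.
  close-path : ∀ fuel {x y} zs → toℕ x + toℕ y < fuel → x ≢ y → 1 ≤ length zs →
               All (λ z → x Fin.< z × y Fin.< z) zs → Unique zs → Linked Hasse (x ∷ zs ∷ʳ y) → Cycle
  close-path (suc fuel) {x} {y} zs x+y<f x≢y long <zs zs! path with Fin.<-cmp x y
  ... | tri≈ _ x≡y _ = contradiction x≡y x≢y
  -- The endpoint with the larger label is the one to move: it has a lower cover, and it exceeds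
  -- both new endpoints, so it can join the interior.
  ... | tri< x<y _ _ = go (descend x<y)
    where
    zsy! : Unique (zs ∷ʳ y)
    zsy! = AllPairs-∷ʳ zs! (All.map (λ (_ , y<z) eq → Fin.<⇒≢ y<z (sym eq)) <zs)
    go : ∃[ y′ ] y′ ⋖ y → Cycle
    go (y′ , y′⋖y@(y′≺y , _)) with x Fin.≟ y′
    ... | yes refl = record
      { v = x ; vs = zs ∷ʳ y
      ; long = subst (2 ≤_) (sym (length-∷ʳ y zs)) (s≤s long)
      ; distinct = All.∷ʳ⁺ (All.map (λ (x<z , _) → Fin.<⇒≢ x<z) <zs) x≢y ∷ zsy!
      ; closed = Linked-∷ʳ (x ∷ zs) path (bwd y′⋖y) }
    ... | no x≢y′ = close-path fuel (zs ∷ʳ y)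
      (<-≤-trans (+-monoʳ-< (toℕ x) (natural y′≺y)) (s≤s⁻¹ x+y<f)) x≢y′
      (subst (1 ≤_) (sym (length-∷ʳ y zs)) (s≤s z≤n))
      (All.∷ʳ⁺ (All.map (λ (x<z , y<z) → x<z , Fin.<-trans (natural y′≺y) y<z) <zs)
                (x<y , natural y′≺y))
      zsy! (Linked-∷ʳ (x ∷ zs) path (bwd y′⋖y))
  ... | tri> _ _ y<x = go (descend y<x)
    where
    xzs! : Unique (x ∷ zs)
    xzs! = All.map (λ (x<z , _) → Fin.<⇒≢ x<z) <zs ∷ zs!
    go : ∃[ x′ ] x′ ⋖ x → Cycle
    go (x′ , x′⋖x@(x′≺x , _)) with x′ Fin.≟ y
    ... | yes refl = record
      { v = y ; vs = x ∷ zs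
      ; long = s≤s long
      ; distinct = (Fin.<⇒≢ y<x ∷ All.map (λ (_ , y<z) → Fin.<⇒≢ y<z) <zs) ∷ xzs!
      ; closed = fwd x′⋖x ∷ path }
    ... | no x′≢y = close-path fuel (x ∷ zs)
      (<-≤-trans (+-monoˡ-< (toℕ y) (natural x′≺x)) (s≤s⁻¹ x+y<f)) x′≢y
      (s≤s z≤n)
      ((natural x′≺x , y<x) ∷ All.map (λ (x<z , y<z) → Fin.<-trans (natural x′≺x) x<z , y<z) <zs)
      xzs! (fwd x′⋖x ∷ path)

  -- Distinct lower covers `b` and `c` in the poset give the path `b`, `a`, `c`, which `close-path`
  -- turns into a cycle. An element of the poset and `⊥₋` cannot both be lower covers, as the former
  -- would lie between `⊥₋` and `a`.
  unique-lower-cover : ∀ {a x y} → _⋖̌_ P x (ι a) → _⋖̌_ P y (ι a) → x ≡ y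
  unique-lower-cover {x = ⊥₋}  {⊥₋}  _ _ = refl
  unique-lower-cover {x = ⊥₋}  {ι c} (_ , ¬between) (c≺a , _) =
    contradiction (ι c , ((⊥₋≤ ι c) , λ ()) , c≺a) ¬between
  unique-lower-cover {x = ι b} {⊥₋}  (b≺a , _) (_ , ¬between) =
    contradiction (ι b , ((⊥₋≤ ι b) , λ ()) , b≺a) ¬between
  unique-lower-cover {a} {ι b} {ι c} ιb⋖ιa ιc⋖ιa with b Fin.≟ c
  ... | yes refl = refl
  ... | no b≢c  = contradiction
    (close-path _ (a ∷ []) ≤-refl b≢c (s≤s z≤n)
      ((natural (proj₁ b⋖a) , natural (proj₁ c⋖a)) ∷ []) ([] ∷ [])
      (fwd b⋖a ∷ bwd c⋖a ∷ [-]))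
    acyclic
    where
    b⋖a = ⋖̌⇒⋖ ιb⋖ιa
    c⋖a = ⋖̌⇒⋖ ιc⋖ιa

  -- parent k is the label below k + 1, and 0 for junk arguments k ≥ n.
  parent : ℕ → ℕ
  parent k with k <? n
  ... | yes k<n = toℕ (label P (proj₁ (lower-cover P (fromℕ< k<n))))
  ... | no  _   = 0

  parent-≤ : ∀ k → parent k ≤ k
  parent-≤ k with k <? n
  ... | yes k<n = ≤-trans
    (s≤s⁻¹ (label-⋖̌ P (proj₂ (lower-cover P (fromℕ< k<n))))) (≤-reflexive (Fin.toℕ-fromℕ< k<n))
  ... | no  _   = z≤n

  parent-⋖̌ : ∀ {x a} → _⋖̌_ P x (ι a) → parent (toℕ a) ≡ toℕ (label P x)
  parent-⋖̌ {x} {a} x⋖a with toℕ a <? n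
  ... | no  a≮n = contradiction (Fin.toℕ<n a) a≮n
  ... | yes a<n = cong (toℕ ∘ label P) (unique-lower-cover
    (subst (_⋖̌_ P _) (cong ι (Fin.fromℕ<-toℕ a a<n)) (proj₂ (lower-cover P (fromℕ< a<n)))) x⋖a)

  -- Descent numbers and `Ldes` in terms of levels

  module _ (τ : Permutation′ n) where

    levelOf : ℕ → ℕ
    levelOf = levels parent (0 ∷ word (flip τ)) n

    position-at : ∀ i → flip τ ⟨ τ ⟨ i ⟩ ⟩ ≡ i
    position-at zero    = refl
    position-at (suc i) = cong suc (inverseˡ τ)

    -- The position of a label in the word of the inverse is its value under `τ`.
    before-descent : ∀ {x y} → x ≢ y →
      before (toℕ (label P y)) (toℕ (label P x)) (0 ∷ word (flip τ)) ≡
      does (τ ⟨ label P y ⟩ Fin.<? τ ⟨ label P x ⟩)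
    before-descent {x} {y} x≢y = trans
      (cong₂ (λ i j → before (toℕ i) (toℕ j) (0 ∷ word (flip τ))) 
        (sym (position-at (label P y))) (sym (position-at (label P x))))
      (before-tabulate {f = λ i → toℕ (flip τ ⟨ i ⟩)} (⟨⟩-injective (flip τ) ∘ Fin.toℕ-injective) _ _
        λ eq → x≢y (sym (label-injective P (⟨⟩-injective τ eq))))

    levelOf-⋖̌ : ∀ {x y} → _⋖̌_ P x y →
      levelOf (toℕ (label P y)) ≡ levelOf (toℕ (label P x)) + descent P τ x y
    levelOf-⋖̌ {x} {⊥₋}  ((⊥₋≤ _ , x≢⊥) , _) = contradiction refl x≢⊥
    levelOf-⋖̌ {x} {ι a} x⋖a@((_ , x≢a) , _)
      rewrite sym (before-descent x≢a) | sym (parent-⋖̌ x⋖a) =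
      levels-suc parent-≤ (0 ∷ word (flip τ)) n (Fin.toℕ<n a)

    -- `levelOf` is a potential for `des`, so the number of descents depends only on the endpoints
    -- of a chain.
    levelOf-chain : ∀ {x y} (C : SaturatedChain P x y) →
      levelOf (toℕ (label P y)) ≡ levelOf (toℕ (label P x)) + des P τ C
    levelOf-chain ε = sym (+-identityʳ _)
    levelOf-chain {x} (_◅_ {j = y} x⋖y C) = trans (levelOf-chain C)
      (trans (cong (_+ des P τ C) (levelOf-⋖̌ x⋖y)) (+-assoc (levelOf (toℕ (label P x))) _ _))

    des≡levelOf : ∀ {x} (C : SaturatedChain P ⊥₋ x) → des P τ C ≡ levelOf (toℕ (label P x))
    des≡levelOf C = sym (trans (levelOf-chain C)
      (cong (_+ des P τ C) (levels-0 parent (0 ∷ word (flip τ)) n)))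

    descentCompatible : DescentCompatible P τ
    descentCompatible a C C′ = trans (des≡levelOf C) (sym (des≡levelOf C′))

    desAt≡levelOf : ∀ x → desAt P τ x ≡ levelOf (toℕ (label P x))
    desAt≡levelOf x = des≡levelOf (saturatedChain P x)

    Ldes≡levelAscents : Ldes P τ ≡ levelAscents parent n (word (flip τ))
    Ldes≡levelAscents = begin
      Ldes P τ
        ≡⟨ length-filter≡sum (ldesPair? P τ) (cartesianProduct elements elements) ⟩
      sum (map (𝟙 ∘ does ∘ ldesPair? P τ) (cartesianProduct elements elements))
        ≡⟨ sum-cartesianProductWith (𝟙 ∘ does ∘ ldesPair? P τ) _,_ elements elements ⟩
      sum (map (λ x → sum (map (λ y → pair x y) elements)) elements)
        ≡⟨ trans (sum-P̌-elements P _)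
                 (sum-cong-≗ λ i → sum-P̌-elements P (pair (unlabel P i))) ⟩
      ∑[ i ≤ n ] ∑[ j ≤ n ] pair (unlabel P i) (unlabel P j)
        ≡⟨ sum-cong-≗ (λ i → sum-cong-≗ (pair≡count i)) ⟩
      ∑[ i ≤ n ] ∑[ j ≤ n ] count (τ ⟨ i ⟩) (τ ⟨ j ⟩) i j
        -- Both sums pass from labels to values of `τ`, so that consecutive values become adjacent
        -- positions in the word of the inverse.
        ≡⟨ trans (∑-permute (λ i → ∑[ j ≤ n ] count (τ ⟨ i ⟩) (τ ⟨ j ⟩) i j) σ)
                 (sum-cong-≗ λ i →
                   ∑-permute (λ j → count (τ ⟨ σ ⟨$⟩ʳ i ⟩) (τ ⟨ j ⟩) (σ ⟨$⟩ʳ i) j) σ) ⟩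
      ∑[ i ≤ n ] ∑[ j ≤ n ] count (τ ⟨ flip τ ⟨ i ⟩ ⟩) (τ ⟨ flip τ ⟨ j ⟩ ⟩) (σ ⟨$⟩ʳ i) (σ ⟨$⟩ʳ j)
        ≡⟨ sum-cong-≗ (λ i → sum-cong-≗ λ j →
             cong₂ (λ p q → count p q (σ ⟨$⟩ʳ i) (σ ⟨$⟩ʳ j)) (at-position i) (at-position j)) ⟩
      ∑[ i ≤ n ] ∑[ j ≤ n ] count i j (σ ⟨$⟩ʳ i) (σ ⟨$⟩ʳ j)
        ≡⟨ adjacencies-consecutive (byLevel levelOf) (λ i → toℕ (σ ⟨$⟩ʳ i)) ⟩
      levelAscents parent n (word (flip τ)) ∎
      where
      open ≡-Reasoning
      σ = lift₀ (flip τ)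
      elements = P̌-elements P
      pair : P̌ P → P̌ P → ℕ
      pair x y = 𝟙 (does (ldesPair? P τ (x , y)))
      count : (p q i j : Fin (suc n)) → ℕ
      count p q i j = 𝟙 (consecutive p q ∧ byLevel levelOf (toℕ i) (toℕ j))
      at-position : ∀ i → τ ⟨ flip τ ⟨ i ⟩ ⟩ ≡ i
      at-position zero    = refl
      at-position (suc i) = cong suc (inverseʳ τ)
      pair≡count : ∀ i j → pair (unlabel P i) (unlabel P j) ≡ count (τ ⟨ i ⟩) (τ ⟨ j ⟩) i j
      pair≡count i j
        rewrite desAt≡levelOf (unlabel P i) | desAt≡levelOf (unlabel P j)
              | label-unlabel P i | label-unlabel P j = refl

-- Big ascents, coefficients and the conclusion

asc²≡bigAscents : ∀ {n} (π : Permutation′ n) → asc² π ≡ bigAscents (word π)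
asc²≡bigAscents {n} π = begin
  asc² π
    ≡⟨ length-filter≡sum (bigAscent? π) (allFin n) ⟩
  sum (map (𝟙 ∘ does ∘ bigAscent? π) (allFin n))
    ≡⟨ cong sum (map-tabulate id (𝟙 ∘ does ∘ bigAscent? π)) ⟩
  sum (tabulate (𝟙 ∘ does ∘ bigAscent? π))
    ≡⟨ adjacencies-tabulate bigAscentᵇ (λ i → toℕ (π ⟨ i ⟩)) ⟨
  bigAscents (word π) ∎
  where open ≡-Reasoning

coeff-⊞ : ∀ p q k → coeff (p ⊞ q) k ≡ coeff p k + coeff q k
coeff-⊞ []      q       k       = refl
coeff-⊞ (c ∷ p) []      k       = sym (+-identityʳ _)
coeff-⊞ (c ∷ p) (d ∷ q) zero    = refl
coeff-⊞ (c ∷ p) (d ∷ q) (suc k) = coeff-⊞ p q k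

coeff-z^ : ∀ m k → coeff (z^ m) k ≡ 𝟙 (m ≡ᵇ k)
coeff-z^ zero    zero    = refl
coeff-z^ zero    (suc k) = refl
coeff-z^ (suc m) zero    = refl
coeff-z^ (suc m) (suc k) = coeff-z^ m k

coeff-Σz^ : ∀ {a} {A : Set a} (stat : A → ℕ) xs k →
            coeff (Σz^ stat xs) k ≡ sum (map (λ x → 𝟙 (stat x ≡ᵇ k)) xs)
coeff-Σz^ stat []       k = refl
coeff-Σz^ stat (x ∷ xs) k = trans (coeff-⊞ (z^ stat x) (Σz^ stat xs) k)
  (cong₂ _+_ (coeff-z^ (stat x) k) (coeff-Σz^ stat xs k))

theorem3p9 : ∀ {ℓ} (n : ℕ) (P : NaturallyLabeledPoset n ℓ) → NaturallyLabeledPoset.IsRootedTree P → 𝓖Ldes P ≋ A² n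
theorem3p9 n P isRootedTree k = begin
  coeff (𝓖Ldes P) k
    ≡⟨ cong (λ τs → coeff (Σz^ (Ldes P) τs) k) (filter-all (descentCompatible? P)
         (All.universal (descentCompatible isRootedTree) (𝔖 n))) ⟩
  coeff (Σz^ (Ldes P) (𝔖 n)) k
    ≡⟨ coeff-Σz^ (Ldes P) (𝔖 n) k ⟩
  Σ𝔖 n (F ∘ Ldes P)
    ≡⟨ Σ𝔖-cong n (λ τ → cong F (Ldes≡levelAscents isRootedTree τ)) ⟩
  Σ𝔖 n (G ∘ word ∘ flip)
    -- `Ldes` is read off the inverse word; inversion permutes `𝔖 n` up to `≈`.
    ≡⟨ Σ𝔖-flip n (G ∘ word) (λ {π} {ρ} π≈ρ → cong G (word-cong {π = π} {ρ} π≈ρ)) ⟨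
  Σ𝔖 n (G ∘ word)
    ≡⟨ equidistribution n (parent-≤ isRootedTree) F ⟩
  Σ𝔖 n (F ∘ bigAscents ∘ word)
    ≡⟨ Σ𝔖-cong n (λ π → cong F (asc²≡bigAscents π)) ⟨
  Σ𝔖 n (F ∘ asc²)
    ≡⟨ coeff-Σz^ asc² (𝔖 n) k ⟨
  coeff (A² n) k ∎
  where
  open ≡-Reasoning
  -- Summing this indicator over a statistic extracts the coefficient at `k`.
  F : ℕ → ℕ
  F m = 𝟙 (m ≡ᵇ k)
  G : List ℕ → ℕ
  G = F ∘ levelAscents (parent isRootedTree) n
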